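{- Let $q \ge 2$ and $n \ge 1$ be integers, and let $C \subseteq H_q^n$ be an equidistant code with distance $d$. (a) If $C$ contains the all-zero codeword $0$ and $|C| > \max\{d^2+d+2,\, q\}$, then $d$ is even, and $C \setminus \{0\}$ is a $\Delta_q(n,d,d/2)$-system. (b) We have $$|C| \le \max\left\{ d^2+d+2,\; q,\; \left\lfloor \frac{2n}{d} \right\rfloor \right\}.$$ In particular, if $n \ge \max\left\{ \frac{d(d^2+d+2)}{2},\, \frac{dq}{2} \right\}$, then $$|C| \le \left\lfloor \frac{2n}{d} \right\rfloor.$$
   Context: $H_q^n = \{0,1,\ldots,q-1\}^n$ is the $q$-ary Hamming space; $x(i)$ denotes the $i$-th coordinate of $x$, $\mathrm{supp}(x) = \{i \in [n] : x(i) \neq 0\}$ with $[n]=\{1,\ldots,n\}$, $\mathrm{wt}(x) = |\mathrm{supp}(x)|$, and $\mathrm{d_H}(x,y) = |\{i \in [n]: x(i) \neq y(i)\}|$. The Johnson space is $J_q^{n,k} = \{x \in H_q^n : \mathrm{wt}(x) = k\}$. An equidistant code with distance $d$ is a set $C \subseteq H_q^n$ whose pairwise Hamming distances between distinct codewords take exactly one value, and this value is $d$ (so $|C|\ge 2$ and $d\ge 1$). A code $C' \subseteq J_q^{n,k}$ is a $\Delta_q(n,k,l)$-system if there is a set $D \subseteq [n]$ (the kernel) with $|D| = l$ such that (1) for any two distinct codewords $x,y \in C'$, $x(i) = y(i) \neq 0$ for all $i \in D$; and (2) the sets $\mathrm{supp}(x) \setminus D$, $x \in C'$, are pairwise disjoint.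 -}

module Defs where

open import Data.Fin.Base using (Fin; toℕ; fromℕ<)
import Data.Fin.Properties as Fin
open import Data.Fin.Subset as Subset using (Subset; ∣_∣; Empty; _∩_; _─_)
open import Data.List.Base using (List)
open import Data.List.Membership.Propositional as List using ()
open import Data.Nat.Base
open import Data.Nat.Properties using (_≟_; <-trans)
open import Data.Product.Base using (Σ-syntax; ∃₂; _×_; _,_)
open import Data.Vec.Base using (Vec; []; _∷_; lookup; replicate; tabulate)
open import Level using (0ℓ)
open import Relation.Binary.PropositionalEquality
  using (_≡_; _≢_; refl; cong)
open import Relation.Nullary using (does; yes; no; ¬?; contradiction)
open import Relation.Unary using (Pred; Decidable; _∈_; _⊆_)

Word : ℕ → ℕ → Set
Word q n = Vec (Fin q) n

0ʷ : ∀ {q n} → .{{NonTrivial q}} → Word q n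
0ʷ {q} {n} = replicate n (fromℕ< (<-trans z<s (nonTrivial⇒n>1 q)))

⁅_⁆ᵈ : ∀ {n} {P : Pred (Fin n) 0ℓ} → Decidable P → Subset n
⁅ P? ⁆ᵈ = tabulate (λ i → does (P? i))

supp : ∀ {q n} → Word q n → Subset n
supp x = ⁅ (λ i → ¬? (toℕ (lookup x i) ≟ 0)) ⁆ᵈ

wt : ∀ {q n} → Word q n → ℕ
wt x = ∣ supp x ∣

d-H : ∀ {q n} → Word q n → Word q n → ℕ
d-H x y = ∣ ⁅ (λ i → ¬? (lookup x i Fin.≟ lookup y i)) ⁆ᵈ ∣

Johnson : (q n k : ℕ) → Pred (Word q n) 0ℓ
Johnson q n k x = wt x ≡ k

-- A finite code is a duplicate-free list of words, so that its cardinality is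
-- the length of the list; `⟦ C ⟧` is the underlying set.
⟦_⟧ : ∀ {q n} → List (Word q n) → Pred (Word q n) 0ℓ
⟦ C ⟧ x = x List.∈ C

record Equidistant {q n : ℕ} (C : Pred (Word q n) 0ℓ) (d : ℕ) : Set where
  field
    attained : ∃₂ λ x y → x ∈ C × y ∈ C × x ≢ y × d-H x y ≡ d
    constant : ∀ {x y} → x ∈ C → y ∈ C → x ≢ y → d-H x y ≡ d

record IsΔSystemWithKernel {q n : ℕ} (C : Pred (Word q n) 0ℓ) (D : Subset n) : Set where
  field
    agree    : ∀ {x y} → x ∈ C → y ∈ C → x ≢ y → ∀ {i} → i Subset.∈ D →
               lookup x i ≡ lookup y i × toℕ (lookup x i) ≢ 0
    disjoint : ∀ {x y} → x ∈ C → y ∈ C → x ≢ y →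
               Empty ((supp x ─ D) ∩ (supp y ─ D))

record IsΔSystem (q n k l : ℕ) (C : Pred (Word q n) 0ℓ) : Set where
  field
    ⊆-Johnson : C ⊆ Johnson q n k
    kernel    : Σ[ D ∈ Subset n ] ∣ D ∣ ≡ l × IsΔSystemWithKernel C D

d-H≡0⇒≡ : ∀ {q n} (x y : Word q n) → d-H x y ≡ 0 → x ≡ y
d-H≡0⇒≡ []      []      _  = refl
d-H≡0⇒≡ (a ∷ x) (b ∷ y) eq with a Fin.≟ b
... | yes refl = cong (a ∷_) (d-H≡0⇒≡ x y eq)
... | no _ with () ← eq

-- Needed to form the quotient ⌊ 2n / d ⌋.
equidistant⇒nonZero : ∀ {q n d} {C : Pred (Word q n) 0ℓ} → Equidistant C d → NonZero d
equidistant⇒nonZero {d = suc _} _ = _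
equidistant⇒nonZero {d = zero}  e =
  let x , y , _ , _ , x≢y , eq = Equidistant.attained e
  in contradiction (d-H≡0⇒≡ x y eq) x≢y

module Submission where

-- Record a code as the 0/1 matrix whose columns are the pairs (i , a), with entry
-- 1 where x(i) = a: it is an equidistant binary code with distance 2d. By the
-- theorem of Deza, in van Lint's form, such a code with more than d² + d + 2
-- words is trivial: in each column all words but at most one agree. If there are also
-- more than q words, then each coordinate i has a symbol c(i) taken by all words
-- but at most one. The words thus differ from the centre c in disjoint sets of
-- coordinates, so d(x,y) = d(x,c) + d(y,c), all radii d(x,c) equal d/2, and
-- |C| d/2 ≤ n. If 0 is a codeword, then the support of c is the kernel.
--
-- For the binary theorem, a quadratic energy identity shows that each column has at
-- most k + 1 ones or at most k + 1 zeros; flip columns so that ones are rare. Counting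
-- ones shows that all rows have weight at least k, with equality for some row, and
-- double counting incidences with the rows of weight k leaves no other weight. Rows
-- of weight k at distance 2k are disjoint.

open import Defs

module Counting where

  open import Data.Bool.Base using (Bool; true; false; _∧_; _xor_; not)
  import Data.Bool.Properties as Bool
  open import Data.Empty using (⊥; ⊥-elim)
  open import Data.Fin.Base
    using (Fin; zero; suc; _↑ˡ_; _↑ʳ_; punchIn; combine; quotient; remainder)
  import Data.Fin.Properties as Fin
  open import Data.Fin.Subset using (∣_∣)
  open import Data.Integer.Base
    using (ℤ; +_; -[1+_]; +[1+_]; 0ℤ; 1ℤ; -_; _+_; _-_; _*_; _≤_; +≤+)
  open import Data.Integer.Properties
  open import Algebra.Properties.AbelianGroup +-0-abelianGroup using (∙-cancelʳ)
  open import Algebra.Properties.Semiring.Sum +-*-semiring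
  open import Data.Integer.Tactic.RingSolver using (solve-∀)
  open import Data.Nat.Base as ℕ using (ℕ)
  import Data.Nat.Properties as ℕ
  open import Data.Product.Base using (Σ-syntax; ∃; _,_; proj₁; proj₂)
  open import Data.Vec.Base using (lookup; tabulate)
  open import Data.Vec.Properties using (lookup∘tabulate)
  open import Function.Base using (_∘_; const)
  open import Function.Definitions using (Injective)
  open import Relation.Binary.PropositionalEquality
  open import Relation.Nullary using (¬_; ¬?; yes; no; does)
  open import Relation.Nullary.Decidable using (dec-true; dec-false)

  -- Finite sums of integers.

  ∑-mono : ∀ {n} {f g : Fin n → ℤ} → (∀ i → f i ≤ g i) → sum f ≤ sum g
  ∑-mono {ℕ.zero}  f≤g = ≤-refl
  ∑-mono {ℕ.suc n} f≤g = +-mono-≤ (f≤g zero) (∑-mono (f≤g ∘ suc))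

  ∑-const : ∀ n c → ∑[ i < n ] c ≡ + n * c
  ∑-const ℕ.zero    c = sym (*-zeroˡ c)
  ∑-const (ℕ.suc n) c = trans (cong₂ _+_ (refl {x = c}) (∑-const n c)) (sym (suc-* (+ n) c))

  ∑-nonneg : ∀ {n} {f : Fin n → ℤ} → (∀ i → 0ℤ ≤ f i) → 0ℤ ≤ sum f
  ∑-nonneg {n} 0≤f = ≤-trans (≤-reflexive (sym (sum-replicate-zero n))) (∑-mono 0≤f)

  term≤∑ : ∀ {n} {f : Fin n → ℤ} → (∀ i → 0ℤ ≤ f i) → ∀ i → f i ≤ sum f
  term≤∑ {ℕ.suc n} {f} 0≤f zero    =
    ≤-trans (≤-reflexive (sym (+-identityʳ (f zero)))) (+-monoʳ-≤ (f zero) (∑-nonneg (0≤f ∘ suc)))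
  term≤∑ {ℕ.suc n} {f} 0≤f (suc i) =
    ≤-trans (≤-reflexive (sym (+-identityˡ (f (suc i))))) (+-mono-≤ (0≤f zero) (term≤∑ (0≤f ∘ suc) i))

  -- Each side receives the `i`-th term of the other, so after `sum-remove` both contain `f i + g i`
  -- and only the remaining terms are compared. Moving the exceptional terms across keeps the
  -- statement free of subtraction.
  ∑-mono-except : ∀ {n} {f g : Fin n → ℤ} (i : Fin n) → (∀ j → i ≢ j → f j ≤ g j) →
                  sum f + g i ≤ sum g + f i
  ∑-mono-except {ℕ.suc n} {f} {g} i f≤g = begin
    sum f + g i          ≡⟨ cong (_+ g i) (sum-remove f) ⟩
    f i + F + g i        ≡⟨ swap-ends (f i) F (g i) ⟩
    g i + F + f i        ≤⟨ +-monoˡ-≤ (f i) (+-monoʳ-≤ (g i) (∑-mono λ j →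
                              f≤g _ (Fin.punchInᵢ≢i i j ∘ sym))) ⟩
    g i + G + f i        ≡⟨ cong (_+ f i) (sum-remove g) ⟨
    sum g + f i          ∎
    where
    open ≤-Reasoning
    F = ∑[ j < n ] f (punchIn i j)
    G = ∑[ j < n ] g (punchIn i j)
    swap-ends : ∀ a b c → a + b + c ≡ c + b + a
    swap-ends = solve-∀

  ∑-cong-except : ∀ {n} {f g : Fin n → ℤ} (i : Fin n) → (∀ j → i ≢ j → f j ≡ g j) →
                  sum f + g i ≡ sum g + f i
  ∑-cong-except i f≡g = ≤-antisym
    (∑-mono-except i λ j i≢j → ≤-reflexive (f≡g j i≢j))
    (∑-mono-except i λ j i≢j → ≤-reflexive (sym (f≡g j i≢j)))

  ∑-↑ : ∀ m {n} (f : Fin (m ℕ.+ n) → ℤ) →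
         sum f ≡ ∑[ i < m ] f (i ↑ˡ n) + ∑[ j < n ] f (m ↑ʳ j)
  ∑-↑ ℕ.zero    f = sym (+-identityˡ _)
  ∑-↑ (ℕ.suc m) f = trans (cong₂ _+_ (refl {x = f zero}) (∑-↑ m (f ∘ suc))) (sym (+-assoc (f zero) _ _))

  ∑-combine : ∀ m {n} (f : Fin (m ℕ.* n) → ℤ) →
              sum f ≡ ∑[ i < m ] ∑[ j < n ] f (combine i j)
  ∑-combine ℕ.zero        f = refl
  ∑-combine (ℕ.suc m) {n} f =
    trans (∑-↑ n f) (cong₂ _+_ (refl {x = ∑[ j < n ] f (j ↑ˡ _)}) (∑-combine m (f ∘ (n ↑ʳ_))))

  ∑-linear : ∀ {n} a b (f g : Fin n → ℤ) →
             ∑[ i < n ] (a * f i + b * g i) ≡ a * sum f + b * sum g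
  ∑-linear a b f g = trans (∑-distrib-+ (λ i → a * f i) (λ i → b * g i))
    (sym (cong₂ _+_ (*-distribˡ-sum a f) (*-distribˡ-sum b g)))

  -- Binary matrices and their row distances.

  ⟨_⟩ : Bool → ℤ
  ⟨ true  ⟩ = 1ℤ
  ⟨ false ⟩ = 0ℤ

  ⟨⟩-nonneg : ∀ a → 0ℤ ≤ ⟨ a ⟩
  ⟨⟩-nonneg true  = +≤+ ℕ.z≤n
  ⟨⟩-nonneg false = ≤-refl

  -- Makes the distance a polynomial in the entries, so that weighted sums of distances can be
  -- evaluated column by column.
  xor-bilinear : ∀ a b → ⟨ a xor b ⟩ ≡ ⟨ a ⟩ + ⟨ b ⟩ - + 2 * (⟨ a ⟩ * ⟨ b ⟩)
  xor-bilinear true  true  = refl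
  xor-bilinear true  false = refl
  xor-bilinear false true  = refl
  xor-bilinear false false = refl

  Matrix : ℕ → ℕ → Set
  Matrix m N = Fin m → Fin N → Bool

  module _ {m N} (f : Matrix m N) where

    distance common : Fin m → Fin m → ℤ
    distance x y = ∑[ j < N ] ⟨ f x j xor f y j ⟩
    common  x y = ∑[ j < N ] ⟨ f x j ∧ f y j ⟩

    weight : Fin m → ℤ
    weight x = ∑[ j < N ] ⟨ f x j ⟩

    degree : Fin N → ℤ
    degree j = ∑[ x < m ] ⟨ f x j ⟩

    Equidistantᵇ : ℤ → Set
    Equidistantᵇ k = ∀ {x y} → x ≢ y → distance x y ≡ + 2 * k

    columnSum : (Fin m → ℤ) → Fin N → ℤ
    columnSum u j = ∑[ x < m ] (u x * ⟨ f x j ⟩)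

  -- The quadratic energy identity.

  -- The double sum separates: each of the summands `a x` and `a y` contributes `U * A`, and the
  -- product term contributes `- + 2 * (A * A)`.
  ∑∑-bilinear : ∀ {n} (u a : Fin n → ℤ) →
    ∑[ x < n ] ∑[ y < n ] (u x * (u y * (a x + a y - + 2 * (a x * a y))))
      ≡ + 2 * (sum u * ∑[ x < n ] (u x * a x) - (∑[ x < n ] (u x * a x)) * (∑[ x < n ] (u x * a x)))
  ∑∑-bilinear {n} u a = begin
    ∑[ x < n ] ∑[ y < n ] (u x * (u y * (a x + a y - + 2 * (a x * a y))))
      ≡⟨ sum-cong-≗ (λ x → trans
           (sum-cong-≗ λ y → expand (u x) (u y) (a x) (a y))
           (∑-linear (u x * a x) (u x - + 2 * (u x * a x)) u (λ y → u y * a y))) ⟩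
    ∑[ x < n ] (u x * a x * U + (u x - + 2 * (u x * a x)) * A)
      ≡⟨ sum-cong-≗ (λ x → regroup (u x) (u x * a x) U A) ⟩
    ∑[ x < n ] (A * u x + (U - + 2 * A) * (u x * a x))
      ≡⟨ ∑-linear A (U - + 2 * A) u (λ x → u x * a x) ⟩
    A * U + (U - + 2 * A) * A
      ≡⟨ collect U A ⟩
    + 2 * (U * A - A * A) ∎
    where
    open ≡-Reasoning
    U = sum u
    A = ∑[ x < n ] (u x * a x)
    expand : ∀ u v a b → u * (v * (a + b - + 2 * (a * b))) ≡ u * a * v + (u - + 2 * (u * a)) * (v * b)
    expand = solve-∀
    regroup : ∀ u ua U A → ua * U + (u - + 2 * ua) * A ≡ A * u + (U - + 2 * A) * ua
    regroup = solve-∀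
    collect : ∀ U A → A * U + (U - + 2 * A) * A ≡ + 2 * (U * A - A * A)
    collect = solve-∀

  xor-same : ∀ a → ⟨ a xor a ⟩ ≡ 0ℤ
  xor-same true  = refl
  xor-same false = refl

  distance-self : ∀ {m N} (f : Matrix m N) x → distance f x x ≡ 0ℤ
  distance-self {N = N} f x = trans (sum-cong-≗ λ j → xor-same (f x j)) (sum-replicate-zero N)

  -- Both sides are half of ∑ₓ ∑ᵧ u(x) u(y) distance(x,y).
  energy : ∀ {m N} (f : Matrix m N) {k} → Equidistantᵇ f k → ∀ u →
           sum u * sum (columnSum f u) - ∑[ j < N ] (columnSum f u j * columnSum f u j)
             ≡ k * (sum u * sum u - ∑[ x < m ] (u x * u x))
  energy {m} {N} f {k} equi u = *-cancelˡ-≡ (+ 2) _ _ (begin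
    + 2 * (U * sum A - ∑[ j < N ] (A j * A j))
      ≡⟨ trans (split U (sum A) (∑[ j < N ] (A j * A j)))
               (sym (∑-linear (+ 2 * U) (- + 2) A (λ j → A j * A j))) ⟩
    ∑[ j < N ] (+ 2 * U * A j + - + 2 * (A j * A j))
      ≡⟨ sum-cong-≗ (λ j → trans
           (sym (split U (A j) (A j * A j)))
           (sym (∑∑-bilinear u (λ x → ⟨ f x j ⟩)))) ⟩
    ∑[ j < N ] ∑[ x < m ] ∑[ y < m ]
      (u x * (u y * (⟨ f x j ⟩ + ⟨ f y j ⟩ - + 2 * (⟨ f x j ⟩ * ⟨ f y j ⟩))))
      ≡⟨ sum-cong-≗ (λ j → sum-cong-≗ λ x → sum-cong-≗ λ y →
           cong (λ d → u x * (u y * d)) (xor-bilinear (f x j) (f y j))) ⟨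
    ∑[ j < N ] ∑[ x < m ] ∑[ y < m ] (u x * (u y * δ x y j))
      ≡⟨ ∑-comm (λ j x → ∑[ y < m ] (u x * (u y * δ x y j))) ⟩
    ∑[ x < m ] ∑[ j < N ] ∑[ y < m ] (u x * (u y * δ x y j))
      ≡⟨ sum-cong-≗ (λ x → ∑-comm (λ j y → u x * (u y * δ x y j))) ⟩
    ∑[ x < m ] ∑[ y < m ] ∑[ j < N ] (u x * (u y * δ x y j))
      ≡⟨ sum-cong-≗ (λ x → sum-cong-≗ λ y → trans
           (cong (u x *_) (*-distribˡ-sum (u y) (δ x y)))
           (*-distribˡ-sum (u x) (λ j → u y * δ x y j))) ⟨
    ∑[ x < m ] ∑[ y < m ] (u x * (u y * distance f x y))
      ≡⟨ sum-cong-≗ row ⟩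
    ∑[ x < m ] (+ 2 * k * U * u x + (- (+ 2 * k)) * (u x * u x))
      ≡⟨ ∑-linear (+ 2 * k * U) (- (+ 2 * k)) u (λ x → u x * u x) ⟩
    + 2 * k * U * U + (- (+ 2 * k)) * ∑[ x < m ] (u x * u x)
      ≡⟨ collect k U (∑[ x < m ] (u x * u x)) ⟩
    + 2 * (k * (U * U - ∑[ x < m ] (u x * u x))) ∎)
    where
    open ≡-Reasoning
    U = sum u
    A = columnSum f u
    δ : Fin m → Fin m → Fin N → ℤ
    δ x y j = ⟨ f x j xor f y j ⟩
    split : ∀ U A B → + 2 * (U * A - B) ≡ + 2 * U * A + - + 2 * B
    split = solve-∀
    collect : ∀ k U B → + 2 * k * U * U + (- (+ 2 * k)) * B ≡ + 2 * (k * (U * U - B))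
    collect = solve-∀
    row-rhs : ∀ v k U → v * (+ 2 * k) * U + v * (v * 0ℤ) - v * (+ 2 * k) * v
                         ≡ + 2 * k * U * v + (- (+ 2 * k)) * (v * v)
    row-rhs = solve-∀
    cancel : ∀ s t → s ≡ s + t - t
    cancel = solve-∀
    -- Every distance from `x` is replaced by `+ 2 * k`, and the diagonal term, where the distance
    -- is 0, is then corrected. This correction produces the sum of squares of `u`.
    row : ∀ x → ∑[ y < m ] (u x * (u y * distance f x y)) ≡ + 2 * k * U * u x + (- (+ 2 * k)) * (u x * u x)
    row x = begin
      S                                      ≡⟨ cancel S (u x * (+ 2 * k) * u x) ⟩
      S + c * u x - c * u x                  ≡⟨ cong (_- c * u x) (∑-cong-except {g = λ y → c * u y} x off) ⟩
      ∑[ y < m ] (c * u y) + u x * (u x * distance f x x) - c * u x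
                                             ≡⟨ cong₂ (λ s d → s + u x * (u x * d) - c * u x)
                                                (sym (*-distribˡ-sum c u)) (distance-self f x) ⟩
      c * U + u x * (u x * 0ℤ) - c * u x     ≡⟨ row-rhs (u x) k U ⟩
      + 2 * k * U * u x + (- (+ 2 * k)) * (u x * u x) ∎
      where
      S = ∑[ y < m ] (u x * (u y * distance f x y))
      c = u x * (+ 2 * k)
      off : ∀ y → x ≢ y → u x * (u y * distance f x y) ≡ c * u y
      off y x≢y = trans (cong (λ d → u x * (u y * d)) (equi x≢y)) (assoc′ (u x) (u y) k)
        where
        assoc′ : ∀ v w k → v * (w * (+ 2 * k)) ≡ v * (+ 2 * k) * w
        assoc′ = solve-∀

  -- Nonnegativity certificates.

  -- A contradictory system of polynomial inequalities is refuted by a combination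
  -- of its nonnegative members, built with _⊕_ and _⊗_, which the ring solver
  -- evaluates to a negative constant.
  infixl 6 _⊕_
  infixl 7 _⊗_

  _⊕_ : ∀ {i j} → 0ℤ ≤ i → 0ℤ ≤ j → 0ℤ ≤ i + j
  _⊕_ = +-mono-≤

  _⊗_ : ∀ {i j} → 0ℤ ≤ i → 0ℤ ≤ j → 0ℤ ≤ i * j
  _⊗_ {+ a} {+ b} _ _ = ≤-trans (+≤+ ℕ.z≤n) (≤-reflexive (pos-* a b))

  nonneg : ∀ {n} → 0ℤ ≤ + n
  nonneg = +≤+ ℕ.z≤n

  square-nonneg : ∀ i → 0ℤ ≤ i * i
  square-nonneg (+ n)    = nonneg {n} ⊗ nonneg {n}
  square-nonneg -[1+ n ] = nonneg

  by-certificate : ∀ {i n} → 0ℤ ≤ i → i ≡ -[1+ n ] → ⊥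
  by-certificate () refl

  ≰⇒1+≤ : ∀ {i j} → ¬ i ≤ j → j + 1ℤ ≤ i
  ≰⇒1+≤ {i} {j} i≰j = ≤-trans (≤-reflexive (+-comm j 1ℤ)) (i<j⇒suc[i]≤j (≰⇒> i≰j))

  -- Weights and common ones of rows.

  ∑-⟨⟩≤1 : ∀ {n} {h : Fin n → Bool} → (∀ {i j} → h i ≡ true → h j ≡ true → i ≡ j) →
           ∑[ i < n ] ⟨ h i ⟩ ≤ 1ℤ
  ∑-⟨⟩≤1 {n} {h} unique with Fin.any? (λ i → h i Bool.≟ true)
  ... | no  none = begin
    ∑[ i < n ] ⟨ h i ⟩  ≡⟨ sum-cong-≗ (λ i → cong ⟨_⟩ (Bool.¬-not (λ hi → none (i , hi)))) ⟩
    ∑[ i < n ] 0ℤ       ≡⟨ sum-replicate-zero n ⟩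
    0ℤ                  ≤⟨ nonneg ⟩
    1ℤ                  ∎
    where open ≤-Reasoning
  ... | yes (i , hi) = begin
    ∑[ i < n ] ⟨ h i ⟩        ≡⟨ +-identityʳ _ ⟨
    ∑[ i < n ] ⟨ h i ⟩ + 0ℤ   ≡⟨ ∑-cong-except i (λ j i≢j → cong ⟨_⟩ (Bool.¬-not (i≢j ∘ unique hi))) ⟩
    ∑[ i < n ] 0ℤ + ⟨ h i ⟩   ≡⟨ cong₂ _+_ (sum-replicate-zero n) (cong ⟨_⟩ hi) ⟩
    1ℤ                        ∎
    where open ≤-Reasoning

  ⟨⟩-idem : ∀ a → ⟨ a ⟩ * ⟨ a ⟩ ≡ ⟨ a ⟩
  ⟨⟩-idem true  = refl
  ⟨⟩-idem false = refl

  ⟨∧⟩ : ∀ a b → ⟨ a ∧ b ⟩ ≡ ⟨ a ⟩ * ⟨ b ⟩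
  ⟨∧⟩ true  true  = refl
  ⟨∧⟩ true  false = refl
  ⟨∧⟩ false true  = refl
  ⟨∧⟩ false false = refl

  ⟨⟩-*-monoʳ : ∀ a {i j} → i ≤ j → ⟨ a ⟩ * i ≤ ⟨ a ⟩ * j
  ⟨⟩-*-monoʳ true  = *-monoˡ-≤-nonNeg 1ℤ
  ⟨⟩-*-monoʳ false _ = ≤-refl

  ∧-trueˡ : ∀ {a b} → a ∧ b ≡ true → a ≡ true
  ∧-trueˡ {true} _ = refl

  ∧-trueʳ : ∀ a {b} → a ∧ b ≡ true → b ≡ true
  ∧-trueʳ true eq = eq

  -- Inclusion-exclusion for the rows seen as sets of columns; the identity already holds in each
  -- single column.
  distance-common : ∀ {m N} (f : Matrix m N) x y →
                    distance f x y + + 2 * common f x y ≡ weight f x + weight f y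
  distance-common {N = N} f x y = begin
    distance f x y + + 2 * common f x y
      ≡⟨ cong (λ s → s + + 2 * common f x y) (*-identityˡ (distance f x y)) ⟨
    1ℤ * distance f x y + + 2 * common f x y
      ≡⟨ ∑-linear 1ℤ (+ 2) (λ j → ⟨ f x j xor f y j ⟩) (λ j → ⟨ f x j ∧ f y j ⟩) ⟨
    ∑[ j < N ] (1ℤ * ⟨ f x j xor f y j ⟩ + + 2 * ⟨ f x j ∧ f y j ⟩)
      ≡⟨ sum-cong-≗ (λ j → pointwise (f x j) (f y j)) ⟩
    ∑[ j < N ] (⟨ f x j ⟩ + ⟨ f y j ⟩)
      ≡⟨ ∑-distrib-+ (λ j → ⟨ f x j ⟩) (λ j → ⟨ f y j ⟩) ⟩
    weight f x + weight f y ∎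
    where
    open ≡-Reasoning
    pointwise : ∀ a b → 1ℤ * ⟨ a xor b ⟩ + + 2 * ⟨ a ∧ b ⟩ ≡ ⟨ a ⟩ + ⟨ b ⟩
    pointwise true  true  = refl
    pointwise true  false = refl
    pointwise false true  = refl
    pointwise false false = refl

  common-nonneg : ∀ {m N} (f : Matrix m N) x y → 0ℤ ≤ common f x y
  common-nonneg f x y = ∑-nonneg (λ j → ⟨⟩-nonneg (f x j ∧ f y j))

  common-self : ∀ {m N} (f : Matrix m N) x → common f x x ≡ weight f x
  common-self f x = sum-cong-≗ (λ j → cong ⟨_⟩ (Bool.∧-idem (f x j)))

  -- Double counting of the pairs (y , j) for which rows `z` and `y` both have a one in column `j`,
  -- a pair being weighted by `u y`.
  ∑-weighted-common : ∀ {m N} (f : Matrix m N) (u : Fin m → ℤ) z →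
    ∑[ y < m ] (u y * common f z y) ≡ ∑[ j < N ] (⟨ f z j ⟩ * columnSum f u j)
  ∑-weighted-common {m} {N} f u z = begin
    ∑[ y < m ] (u y * common f z y)
      ≡⟨ sum-cong-≗ (λ y → *-distribˡ-sum (u y) (λ j → ⟨ f z j ∧ f y j ⟩)) ⟩
    ∑[ y < m ] ∑[ j < N ] (u y * ⟨ f z j ∧ f y j ⟩)
      ≡⟨ ∑-comm (λ y j → u y * ⟨ f z j ∧ f y j ⟩) ⟩
    ∑[ j < N ] ∑[ y < m ] (u y * ⟨ f z j ∧ f y j ⟩)
      ≡⟨ sum-cong-≗ (λ j → trans
           (sum-cong-≗ λ y → trans (cong (λ s → u y * s) (⟨∧⟩ (f z j) (f y j)))
                                   (shuffle (u y) ⟨ f z j ⟩ ⟨ f y j ⟩))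
           (sym (*-distribˡ-sum ⟨ f z j ⟩ (λ y → u y * ⟨ f y j ⟩)))) ⟩
    ∑[ j < N ] (⟨ f z j ⟩ * columnSum f u j) ∎
    where
    open ≡-Reasoning
    shuffle : ∀ u a b → u * (a * b) ≡ a * (u * b)
    shuffle = solve-∀

  -- Columns of a large equidistant matrix.

  -- The energy identity at the centred column u = M f(·,j) − t, with t the degree
  -- of column j, gives t (M − t) ≤ k M, so that t or M − t is at most k + 1.
  module Large {m N} (f : Matrix m N) {k} (0≤k : 0ℤ ≤ k) (equi : Equidistantᵇ f k)
               (large : k * k + k + + 3 ≤ + m) where

    private
      M = + m
      0≤large = i≤j⇒0≤j-i large

    module _ (j : Fin N) where
      private
        t = degree f j
        u : Fin m → ℤ
        -- The deviation of column `j` from its mean t / M, scaled by `M` to stay integral.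
        u x = M * ⟨ f x j ⟩ + (- t) * 1ℤ

      centred : sum u ≡ 0ℤ
      centred = trans (∑-linear M (- t) (λ x → ⟨ f x j ⟩) (const 1ℤ))
        (trans (cong (λ s → M * t + (- t) * s) (∑-const m 1ℤ)) (cancel M t))
        where
        cancel : ∀ M t → M * t + (- t) * (M * 1ℤ) ≡ 0ℤ
        cancel = solve-∀

      centred-column : columnSum f u j ≡ t * (M - t)
      centred-column = trans (sum-cong-≗ λ x → pointwise M t ⟨ f x j ⟩ (⟨⟩-idem (f x j)))
        (trans (sym (*-distribˡ-sum (M - t) (λ x → ⟨ f x j ⟩))) (*-comm (M - t) t))
        where
        expand : ∀ M t a → (M * a + (- t) * 1ℤ) * a ≡ M * (a * a) - t * a
        expand = solve-∀
        factor : ∀ M t a → M * a - t * a ≡ (M - t) * a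
        factor = solve-∀
        pointwise : ∀ M t a → a * a ≡ a → (M * a + (- t) * 1ℤ) * a ≡ (M - t) * a
        pointwise M t a eq = trans (expand M t a) (trans (cong (λ s → M * s - t * a) eq) (factor M t a))

      centred-squares : ∑[ x < m ] (u x * u x) ≡ M * (t * (M - t))
      centred-squares = trans (sum-cong-≗ λ x → pointwise M t ⟨ f x j ⟩ (⟨⟩-idem (f x j)))
        (trans (∑-linear (M * (M - + 2 * t)) (t * t) (λ x → ⟨ f x j ⟩) (const 1ℤ))
        (trans (cong (λ s → M * (M - + 2 * t) * t + t * t * s) (∑-const m 1ℤ)) (collect M t)))
        where
        expand : ∀ M t a → (M * a + (- t) * 1ℤ) * (M * a + (- t) * 1ℤ)
                           ≡ M * M * (a * a) + (- + 2 * M * t * a + t * t * 1ℤ)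
        expand = solve-∀
        factor : ∀ M t a → M * M * a + (- + 2 * M * t * a + t * t * 1ℤ)
                           ≡ M * (M - + 2 * t) * a + t * t * 1ℤ
        factor = solve-∀
        pointwise : ∀ M t a → a * a ≡ a →
          (M * a + (- t) * 1ℤ) * (M * a + (- t) * 1ℤ) ≡ M * (M - + 2 * t) * a + t * t * 1ℤ
        pointwise M t a eq = trans (expand M t a)
          (trans (cong (λ s → M * M * s + (- + 2 * M * t * a + t * t * 1ℤ)) eq) (factor M t a))
        collect : ∀ M t → M * (M - + 2 * t) * t + t * t * (M * 1ℤ) ≡ M * (t * (M - t))
        collect = solve-∀

      -- With p = t (M - t) and `sum u` zero, the energy identity says that the squares of the
      -- column sums add up to k M p. The square at `j` alone is p².
      degree-energy : t * (M - t) * (t * (M - t)) ≤ k * (M * (t * (M - t)))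
      degree-energy = begin
        t * (M - t) * (t * (M - t))  ≡⟨ cong₂ _*_ centred-column centred-column ⟨
        A j * A j                    ≤⟨ term≤∑ (λ i → square-nonneg (A i)) j ⟩
        ΣA²                          ≡⟨ drop-centred U (sum A) ΣA² centred ⟩
        - (U * sum A - ΣA²)          ≡⟨ cong -_ (energy f equi u) ⟩
        - (k * (U * U - Σu²))        ≡⟨ cong₂ (λ s q → - (k * (s * s - q))) centred centred-squares ⟩
        - (k * (0ℤ * 0ℤ - M * (t * (M - t)))) ≡⟨ simplify k (M * (t * (M - t))) ⟩
        k * (M * (t * (M - t)))      ∎
        where
        open ≤-Reasoning
        A = columnSum f u
        U = sum u
        ΣA² = ∑[ i < N ] (A i * A i)
        Σu² = ∑[ x < m ] (u x * u x)
        drop₀ : ∀ S Q → Q ≡ - (0ℤ * S - Q)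
        drop₀ = solve-∀
        drop-centred : ∀ U S Q → U ≡ 0ℤ → Q ≡ - (U * S - Q)
        drop-centred _ S Q refl = drop₀ S Q
        simplify : ∀ k q → - (k * (0ℤ * 0ℤ - q)) ≡ k * q
        simplify = solve-∀

      codegree≤k+1 : ¬ degree f j ≤ k + 1ℤ → M - degree f j ≤ k + 1ℤ
      codegree≤k+1 t≰ with M - degree f j ≤? k + 1ℤ
      ... | yes s≤ = s≤
      ... | no  s≰ = ⊥-elim (by-certificate
              -- If t and M - t are both at least k + 2, the bracket is nonnegative and equals p - k
              -- M - 1 for p = t (M - t). Multiplied by p ≥ 1, this contradicts p² ≤ k M p.
              (0≤p ⊗ (a ⊗ b ⊕ nonneg {2} ⊗ 0≤large ⊕ square-nonneg (k - 1ℤ))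
                ⊕ i≤j⇒0≤j-i degree-energy ⊕ 1≤p)
              (certificate t k M))
        where
        a = i≤j⇒0≤j-i (≰⇒1+≤ t≰)
        b = i≤j⇒0≤j-i (≰⇒1+≤ s≰)
        0≤k+2 = 0≤k ⊕ nonneg {2}
        1≤p : 0ℤ ≤ t * (M - t) - 1ℤ
        1≤p = ≤-trans (a ⊗ b ⊕ 0≤k+2 ⊗ a ⊕ 0≤k+2 ⊗ b ⊕ 0≤k ⊗ 0≤k ⊕ nonneg {4} ⊗ 0≤k ⊕ nonneg {3})
                      (≤-reflexive (product t (M - t) k))
          where
          product : ∀ t s k → (t - (k + 1ℤ + 1ℤ)) * (s - (k + 1ℤ + 1ℤ)) + (k + + 2) * (t - (k + 1ℤ + 1ℤ))
                      + (k + + 2) * (s - (k + 1ℤ + 1ℤ)) + k * k + + 4 * k + + 3 ≡ t * s - 1ℤ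
          product = solve-∀
        0≤p : 0ℤ ≤ t * (M - t)
        0≤p = ≤-trans (1≤p ⊕ nonneg {1}) (≤-reflexive (add-back (t * (M - t))))
          where
          add-back : ∀ p → p - 1ℤ + 1ℤ ≡ p
          add-back = solve-∀
        certificate : ∀ t k M → t * (M - t) * ((t - (k + 1ℤ + 1ℤ)) * (M - t - (k + 1ℤ + 1ℤ))
                        + + 2 * (M - (k * k + k + + 3)) + (k - 1ℤ) * (k - 1ℤ))
                      + (k * (M * (t * (M - t))) - t * (M - t) * (t * (M - t))) + (t * (M - t) - 1ℤ) ≡ -[1+ 0 ]
        certificate = solve-∀

  -- Equidistant matrices with sparse columns.

  module Sparse {m N} (f : Matrix m N) {k} (0≤k : 0ℤ ≤ k) (equi : Equidistantᵇ f k)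
                (large : k * k + k + + 3 ≤ + m) (sparse : ∀ j → degree f j ≤ k + 1ℤ) where

    private
      M = + m
      W = ∑[ j < N ] degree f j
      0≤large = i≤j⇒0≤j-i large

      0≤m-k-1 : 0ℤ ≤ M - k - 1ℤ
      0≤m-k-1 = ≤-trans (0≤large ⊕ 0≤k ⊗ 0≤k ⊕ nonneg {2}) (≤-reflexive (regroup k M))
        where
        regroup : ∀ k M → M - (k * k + k + + 3) + k * k + + 2 ≡ M - k - 1ℤ
        regroup = solve-∀

    weight-pair : ∀ {x y} → x ≢ y → + 2 * k + + 2 * common f x y ≡ weight f x + weight f y
    weight-pair {x} {y} x≢y =
      trans (cong (λ d → d + + 2 * common f x y) (sym (equi x≢y))) (distance-common f x y)

    total-weight : ∑[ x < m ] weight f x ≡ W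
    total-weight = ∑-comm λ x j → ⟨ f x j ⟩

    -- The energy identity at the constant 1 evaluates M W - Σ t², where t runs over the column
    -- degrees; sparsity gives Σ t² ≤ (k + 1) W.
    total-weight-bound : (M - k - 1ℤ) * W ≤ k * (M * M - M)
    total-weight-bound = 0≤i-j⇒j≤i (≤-trans (i≤j⇒0≤j-i ΣA²≤) (≤-reflexive
        (trans (rearrange k M W ΣA²) (cong (λ e → e - (M - k - 1ℤ) * W) energy₁))))
      where
      A = columnSum f (const 1ℤ)
      ΣA² = ∑[ j < N ] (A j * A j)
      A≡degree : ∀ j → A j ≡ degree f j
      A≡degree j = sum-cong-≗ λ x → *-identityˡ ⟨ f x j ⟩
      ΣA²≤ : ΣA² ≤ (k + 1ℤ) * W
      ΣA²≤ = ≤-trans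
        (∑-mono λ j → 0≤i-j⇒j≤i (≤-trans
          (i≤j⇒0≤j-i (sparse j) ⊗ ∑-nonneg (λ x → ⟨⟩-nonneg (f x j)))
          (≤-reflexive (trans (difference (k + 1ℤ) (degree f j))
                              (cong (λ a → (k + 1ℤ) * degree f j - a * a) (sym (A≡degree j)))))))
        (≤-reflexive (sym (*-distribˡ-sum (k + 1ℤ) (degree f))))
        where
        difference : ∀ c t → (c - t) * t ≡ c * t - t * t
        difference = solve-∀
      energy₁ : M * W - ΣA² ≡ k * (M * M - M)
      energy₁ = trans (cong₂ (λ u a → u * a - ΣA²) (sym ∑1≡M) (sym (sum-cong-≗ A≡degree)))
        (trans (energy f equi (const 1ℤ)) (cong (λ u → k * (u * u - u)) ∑1≡M))
        where
        ∑1≡M : ∑[ x < m ] 1ℤ ≡ M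
        ∑1≡M = trans (∑-const m 1ℤ) (*-identityʳ M)
      rearrange : ∀ k M W Q → (k + 1ℤ) * W - Q ≡ M * W - Q - (M - k - 1ℤ) * W
      rearrange = solve-∀

    -- Two rows at distance 2k have weights adding up to at least 2k, so a row of weight w < k
    -- pushes every other row up to 2k - w ≥ k + 1. The total then violates `total-weight-bound`.
    weight≥k : ∀ x → k ≤ weight f x
    weight≥k x with k ≤? weight f x
    ... | yes k≤w = k≤w
    ... | no  k≰w = ⊥-elim (by-certificate
            (0≤m-k-1 ⊗ i≤j⇒0≤j-i total ⊕ 0≤m-k-1 ⊗ 0≤m-2 ⊗ i≤j⇒0≤j-i (≰⇒1+≤ k≰w)
              ⊕ i≤j⇒0≤j-i total-weight-bound ⊕ nonneg {m} ⊗ 0≤large ⊕ nonneg {2} ⊗ 0≤k)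
            (certificate k M W w))
      where
      w = weight f x
      0≤m-2 : 0ℤ ≤ M - + 2
      0≤m-2 = ≤-trans (0≤large ⊕ 0≤k ⊗ 0≤k ⊕ 0≤k ⊕ nonneg {1}) (≤-reflexive (regroup k M))
        where
        regroup : ∀ k M → M - (k * k + k + + 3) + k * k + k + 1ℤ ≡ M - + 2
        regroup = solve-∀
      others : ∀ y → x ≢ y → + 2 * k - w ≤ weight f y
      others y x≢y = 0≤i-j⇒j≤i (≤-trans (nonneg {2} ⊗ common-nonneg f x y)
        (≤-reflexive (trans (isolate k (common f x y))
          (trans (cong (λ s → s - + 2 * k) (weight-pair x≢y)) (move w (weight f y) k)))))
        where
        isolate : ∀ k c → + 2 * c ≡ + 2 * k + + 2 * c - + 2 * k
        isolate = solve-∀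
        move : ∀ w v k → w + v - + 2 * k ≡ v - (+ 2 * k - w)
        move = solve-∀
      total : M * (+ 2 * k - w) + w ≤ W + (+ 2 * k - w)
      total = subst₂ (λ s t → s + w ≤ t + (+ 2 * k - w)) (∑-const m _) total-weight (∑-mono-except x others)
      certificate : ∀ k M W w →
        (M - k - 1ℤ) * (W + (+ 2 * k - w) - (M * (+ 2 * k - w) + w))
          + (M - k - 1ℤ) * (M - + 2) * (k - (w + 1ℤ))
          + (k * (M * M - M) - (M - k - 1ℤ) * W) + M * (M - (k * k + k + + 3)) + + 2 * k ≡ -[1+ 1 ]
      certificate = solve-∀

    -- If all rows had weight at least k + 1, then W ≥ M (k + 1), and `total-weight-bound` would
    -- force M ≤ k² + k + 1.
    ∃-weight-k : ∃ λ x → weight f x ≡ k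
    ∃-weight-k with Fin.any? (λ x → weight f x ≤? k)
    ... | yes (x , w≤k) = x , ≤-antisym w≤k (weight≥k x)
    ... | no  none      = ⊥-elim (by-certificate
            (0≤m-k-1 ⊗ i≤j⇒0≤j-i total ⊕ i≤j⇒0≤j-i total-weight-bound ⊕ nonneg {m} ⊗ 0≤large
              ⊕ nonneg {2} ⊗ (0≤large ⊕ 0≤k ⊗ 0≤k ⊕ 0≤k))
            (certificate k M W))
      where
      total : M * (k + 1ℤ) ≤ W
      total = subst₂ _≤_ (∑-const m (k + 1ℤ)) total-weight (∑-mono λ x → ≰⇒1+≤ λ w≤k → none (x , w≤k))
      certificate : ∀ k M W → (M - k - 1ℤ) * (W - M * (k + 1ℤ)) + (k * (M * M - M) - (M - k - 1ℤ) * W)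
                      + M * (M - (k * k + k + + 3)) + + 2 * (M - (k * k + k + + 3) + k * k + k) ≡ -[1+ 5 ]
      certificate = solve-∀

    -- For distinct rows, `weight-pair` reads 2k + 2c = k + k, so the number c of common ones
    -- vanishes.
    minimal-disjoint : ∀ {x y j} → weight f x ≡ k → weight f y ≡ k → f x j ≡ true → f y j ≡ true → x ≡ y
    minimal-disjoint {x} {y} {j} wx wy fx fy with x Fin.≟ y
    ... | yes x≡y = x≡y
    ... | no  x≢y = ⊥-elim (by-certificate (nonneg {2} ⊗ i≤j⇒0≤j-i 1≤c)
          (trans (isolate k c) (trans
            (cong (λ s → s - (k + k) - + 2) (trans (weight-pair x≢y) (cong₂ _+_ wx wy)))
            (cancel k))))
      where
      c = common f x y
      1≤c : 1ℤ ≤ c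
      1≤c = subst (λ a → a ≤ c) (cong₂ (λ a b → ⟨ a ∧ b ⟩) fx fy)
        (term≤∑ (λ i → ⟨⟩-nonneg (f x i ∧ f y i)) j)
      isolate : ∀ k c → + 2 * (c - 1ℤ) ≡ + 2 * k + + 2 * c - (k + k) - + 2
      isolate = solve-∀
      cancel : ∀ k → k + k - (k + k) - + 2 ≡ -[1+ 1 ]
      cancel = solve-∀

    private
      minimal : Fin m → Bool
      minimal x = does (weight f x ≟ k)

      minimal⇒ : ∀ {x} → minimal x ≡ true → weight f x ≡ k
      minimal⇒ {x} eq with weight f x ≟ k
      ... | yes w≡k = w≡k

      r = ∑[ x < m ] ⟨ minimal x ⟩

    -- The intersection size depends on `z` alone, so `z` meets all other rows of weight `k` equally
    -- often.
    minimal-common : ∀ {x z} → x ≢ z → weight f x ≡ k → + 2 * common f x z + k ≡ weight f z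
    minimal-common {x} {z} x≢z wx = begin
      + 2 * common f x z + k                ≡⟨ isolate k (common f x z) ⟩
      + 2 * k + + 2 * common f x z - k      ≡⟨ cong₂ _-_ (weight-pair x≢z) (sym wx) ⟩
      weight f x + weight f z - weight f x  ≡⟨ cancel (weight f x) (weight f z) ⟩
      weight f z                            ∎
      where
      open ≡-Reasoning
      isolate : ∀ k c → + 2 * c + k ≡ + 2 * k + + 2 * c - k
      isolate = solve-∀
      cancel : ∀ v w → v + w - v ≡ w
      cancel = solve-∀

    common-pos : ∀ {x z} → x ≢ z → weight f x ≡ k → weight f z ≢ k → 1ℤ ≤ common f x z
    common-pos {x} {z} x≢z wx wz≢k with common f x z in eq | common-nonneg f x z
    ... | + ℕ.zero  | _ = ⊥-elim (wz≢k (trans (sym (minimal-common x≢z wx))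
                              (trans (cong (λ c → + 2 * c + k) eq) (+-identityˡ k))))
    ... | +[1+ n ]  | _ = +≤+ (ℕ.s≤s ℕ.z≤n)

    -- Every row of another weight meets x, and x meets few rows as columns are sparse.
    few-nonminimal : ∀ {x} → weight f x ≡ k → M - r + k ≤ (k + 1ℤ) * k
    few-nonminimal {x} wx = begin
      -- The summand `k` is what `x` contributes by meeting itself.
      M - r + k                                               ≡⟨ cong₂ _+_ M-r (trans (sym wx) (sym (common-self f x))) ⟩
      ∑[ y < m ] (1ℤ * 1ℤ + - 1ℤ * ⟨ minimal y ⟩) + common f x x
                                                              ≤⟨ ∑-mono-except x pointwise ⟩
      ∑[ y < m ] common f x y + (1ℤ * 1ℤ + - 1ℤ * ⟨ minimal x ⟩)
        ≡⟨ cong₂ _+_ (sum-cong-≗ λ y → sym (*-identityˡ (common f x y))) self ⟩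
      ∑[ y < m ] (1ℤ * common f x y) + 0ℤ                     ≡⟨ +-identityʳ _ ⟩
      ∑[ y < m ] (1ℤ * common f x y)                          ≡⟨ ∑-weighted-common f (const 1ℤ) x ⟩
      ∑[ j < N ] (⟨ f x j ⟩ * columnSum f (const 1ℤ) j)       ≤⟨ ∑-mono (λ j → ⟨⟩-*-monoʳ (f x j) (column j)) ⟩
      ∑[ j < N ] (⟨ f x j ⟩ * (k + 1ℤ))                       ≡⟨ *-distribʳ-sum (k + 1ℤ) (λ j → ⟨ f x j ⟩) ⟨
      weight f x * (k + 1ℤ)                                   ≡⟨ cong (λ w → w * (k + 1ℤ)) wx ⟩
      k * (k + 1ℤ)                                            ≡⟨ *-comm k (k + 1ℤ) ⟩
      (k + 1ℤ) * k                                            ∎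
      where
      open ≤-Reasoning
      regroup : ∀ M r → M - r ≡ 1ℤ * (M * 1ℤ) + - 1ℤ * r
      regroup = solve-∀
      M-r : M - r ≡ ∑[ y < m ] (1ℤ * 1ℤ + - 1ℤ * ⟨ minimal y ⟩)
      M-r = trans (regroup M r) (trans (cong (λ s → 1ℤ * s + - 1ℤ * r) (sym (∑-const m 1ℤ)))
              (sym (∑-linear 1ℤ (- 1ℤ) (const 1ℤ) (λ y → ⟨ minimal y ⟩))))
      self : 1ℤ * 1ℤ + - 1ℤ * ⟨ minimal x ⟩ ≡ 0ℤ
      self with weight f x ≟ k
      ... | yes _    = refl
      ... | no  wx≢k = ⊥-elim (wx≢k wx)
      pointwise : ∀ y → x ≢ y → 1ℤ * 1ℤ + - 1ℤ * ⟨ minimal y ⟩ ≤ common f x y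
      pointwise y x≢y with weight f y ≟ k
      ... | yes _    = common-nonneg f x y
      ... | no  wy≢k = common-pos x≢y wx wy≢k
      column : ∀ j → columnSum f (const 1ℤ) j ≤ k + 1ℤ
      column j = ≤-trans (≤-reflexive (sum-cong-≗ λ y → *-identityˡ ⟨ f y j ⟩)) (sparse j)

    -- The rows of weight k are disjoint and z meets each of them in equally many
    -- columns, whereas z has only k + 2 c of them.
    few-minimal : ∀ {x z} → x ≢ z → weight f x ≡ k → weight f z ≢ k → r * common f x z ≤ k + + 2 * common f x z
    few-minimal {x} {z} x≢z wx wz≢k = begin
      r * c                                       ≡⟨ *-distribʳ-sum c (λ y → ⟨ minimal y ⟩) ⟩
      ∑[ y < m ] (⟨ minimal y ⟩ * c)              ≡⟨ sum-cong-≗ pointwise ⟩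
      ∑[ y < m ] (⟨ minimal y ⟩ * common f z y)   ≡⟨ ∑-weighted-common f (λ y → ⟨ minimal y ⟩) z ⟩
      ∑[ j < N ] (⟨ f z j ⟩ * columnSum f (λ y → ⟨ minimal y ⟩) j)
                                                  ≤⟨ ∑-mono (λ j → ⟨⟩-*-monoʳ (f z j) (column j)) ⟩
      ∑[ j < N ] (⟨ f z j ⟩ * 1ℤ)                 ≡⟨ sum-cong-≗ (λ j → *-identityʳ ⟨ f z j ⟩) ⟩
      weight f z                                  ≡⟨ minimal-common x≢z wx ⟨
      + 2 * c + k                                 ≡⟨ +-comm (+ 2 * c) k ⟩
      k + + 2 * c                                 ∎
      where
      open ≤-Reasoning
      c = common f x z
      common-sym : ∀ y → common f y z ≡ common f z y
      common-sym y = sum-cong-≗ λ j → cong ⟨_⟩ (Bool.∧-comm (f y j) (f z j))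
      pointwise : ∀ y → ⟨ minimal y ⟩ * c ≡ ⟨ minimal y ⟩ * common f z y
      pointwise y with weight f y ≟ k
      ... | no  _  = refl
      ... | yes wy = cong (λ s → 1ℤ * s) (*-cancelˡ-≡ (+ 2) _ _ (∙-cancelʳ k _ _
              (trans (minimal-common x≢z wx) (trans (sym (minimal-common y≢z wy))
                (cong (λ s → + 2 * s + k) (common-sym y))))))
        where
        y≢z : y ≢ z
        y≢z refl = wz≢k wy
      column : ∀ j → columnSum f (λ y → ⟨ minimal y ⟩) j ≤ 1ℤ
      column j = ≤-trans (≤-reflexive (sum-cong-≗ λ y → sym (⟨∧⟩ (minimal y) (f y j))))
        (∑-⟨⟩≤1 λ {y} {y′} hy hy′ → minimal-disjoint
          (minimal⇒ (∧-trueˡ hy)) (minimal⇒ (∧-trueˡ hy′))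
          (∧-trueʳ (minimal y) hy) (∧-trueʳ (minimal y′) hy′))

    -- Given a row `z` of another weight, `few-nonminimal` leaves at least k + 3 rows of weight `k`,
    -- whereas `few-minimal` with at least one common column allows at most k + 2.
    weight≡k : ∀ z → weight f z ≡ k
    weight≡k z with weight f z ≟ k | ∃-weight-k
    ... | yes wz≡k | _      = wz≡k
    ... | no  wz≢k | x , wx = ⊥-elim (by-certificate
            (i≤j⇒0≤j-i (few-minimal x≢z wx wz≢k)
              ⊕ (i≤j⇒0≤j-i (few-nonminimal wx) ⊕ 0≤large) ⊗ common-nonneg f x z
              ⊕ (0≤k ⊕ nonneg {1}) ⊗ i≤j⇒0≤j-i (common-pos x≢z wx wz≢k))
            (certificate k M r (common f x z)))
      where
      x≢z : x ≢ z
      x≢z refl = wz≢k wx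
      certificate : ∀ k M r c → k + + 2 * c - r * c
                      + ((k + 1ℤ) * k - (M - r + k) + (M - (k * k + k + + 3))) * c
                      + (k + 1ℤ) * (c - 1ℤ) ≡ -[1+ 0 ]
      certificate = solve-∀

    columns-unique : ∀ {x y j} → f x j ≡ true → f y j ≡ true → x ≡ y
    columns-unique {x} {y} = minimal-disjoint (weight≡k x) (weight≡k y)

  -- The binary theorem, by flipping columns.

  -- Here b j is the majority value of column j.
  sunflower : ∀ {m N} (f : Matrix m N) {k} → 0ℤ ≤ k → Equidistantᵇ f k → k * k + k + + 3 ≤ + m →
              Σ[ b ∈ (Fin N → Bool) ] (∀ {x y} j → f x j ≢ b j → f y j ≢ b j → x ≡ y)
  sunflower {m} {N} f {k} 0≤k equi large = b , λ j fx≢b fy≢b →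
      Sparse.columns-unique g 0≤k g-equi large g-sparse (≢⇒xor fx≢b) (≢⇒xor fy≢b)
    where
    open Large f 0≤k equi large
    b : Fin N → Bool
    b j = not (does (degree f j ≤? k + 1ℤ))
    g : Matrix m N
    g x j = f x j xor b j

    ≢⇒xor : ∀ {a c} → a ≢ c → a xor c ≡ true
    ≢⇒xor {true}  {true}  a≢c = ⊥-elim (a≢c refl)
    ≢⇒xor {true}  {false} a≢c = refl
    ≢⇒xor {false} {true}  a≢c = refl
    ≢⇒xor {false} {false} a≢c = ⊥-elim (a≢c refl)

    flip-both : ∀ a c d → (a xor d) xor (c xor d) ≡ a xor c
    flip-both true  true  true  = refl
    flip-both true  true  false = refl
    flip-both true  false true  = refl
    flip-both true  false false = refl
    flip-both false true  true  = refl
    flip-both false true  false = refl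
    flip-both false false true  = refl
    flip-both false false false = refl

    g-equi : Equidistantᵇ g k
    g-equi {x} {y} x≢y = trans (sum-cong-≗ λ j → cong ⟨_⟩ (flip-both (f x j) (f y j) (b j))) (equi x≢y)

    flip-true : ∀ a → ⟨ a xor true ⟩ ≡ 1ℤ * 1ℤ + - 1ℤ * ⟨ a ⟩
    flip-true true  = refl
    flip-true false = refl

    g-sparse : ∀ j → degree g j ≤ k + 1ℤ
    g-sparse j with degree f j ≤? k + 1ℤ
    ... | yes t≤ = ≤-trans (≤-reflexive (sum-cong-≗ λ x → cong ⟨_⟩ (Bool.xor-identityʳ (f x j)))) t≤
    ... | no  t≰ = ≤-trans (≤-reflexive (begin
        ∑[ x < m ] ⟨ f x j xor true ⟩                ≡⟨ sum-cong-≗ (λ x → flip-true (f x j)) ⟩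
        ∑[ x < m ] (1ℤ * 1ℤ + - 1ℤ * ⟨ f x j ⟩)      ≡⟨ ∑-linear 1ℤ (- 1ℤ) (const 1ℤ) (λ x → ⟨ f x j ⟩) ⟩
        1ℤ * ∑[ x < m ] 1ℤ + - 1ℤ * degree f j       ≡⟨ cong (λ s → 1ℤ * s + - 1ℤ * degree f j) (∑-const m 1ℤ) ⟩
        1ℤ * (+ m * 1ℤ) + - 1ℤ * degree f j          ≡⟨ regroup (+ m) (degree f j) ⟩
        + m - degree f j                             ∎)) (codegree≤k+1 j t≰)
      where
      open ≡-Reasoning
      regroup : ∀ M t → 1ℤ * (M * 1ℤ) + - 1ℤ * t ≡ M - t
      regroup = solve-∀

  -- From words to binary matrices.

  ∣tabulate∣≡∑ : ∀ {n} (h : Fin n → Bool) → + ∣ tabulate h ∣ ≡ ∑[ i < n ] ⟨ h i ⟩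
  ∣tabulate∣≡∑ {ℕ.zero}  h = refl
  ∣tabulate∣≡∑ {ℕ.suc n} h with h zero
  ... | true  = cong (λ s → 1ℤ + s) (∣tabulate∣≡∑ (h ∘ suc))
  ... | false = trans (∣tabulate∣≡∑ (h ∘ suc)) (sym (+-identityˡ _))

  differ : ∀ {q} → Fin q → Fin q → Bool
  differ a b = does (¬? (a Fin.≟ b))

  differ-true : ∀ {q} {a b : Fin q} → differ a b ≡ true → a ≢ b
  differ-true {a = a} {b} eq with a Fin.≟ b
  ... | no a≢b = a≢b

  oneHot : ∀ {q} → Matrix q q
  oneHot p a = does (p Fin.≟ a)

  -- Distinct unit vectors have weight one each and nothing in common. Hence the encoding exactly
  -- doubles Hamming distances, as the form 2k in `Equidistantᵇ` requires.
  oneHot-distance : ∀ {q} (p r : Fin q) → distance oneHot p r ≡ + 2 * ⟨ differ p r ⟩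
  oneHot-distance {q} p r with p Fin.≟ r
  ... | yes refl = distance-self oneHot p
  ... | no  p≢r  = begin
    distance oneHot p r                               ≡⟨ +-identityʳ _ ⟨
    distance oneHot p r + + 2 * 0ℤ                    ≡⟨ cong (λ s → distance oneHot p r + + 2 * s) no-common ⟨
    distance oneHot p r + + 2 * common oneHot p r     ≡⟨ distance-common oneHot p r ⟩
    weight oneHot p + weight oneHot r                 ≡⟨ cong₂ _+_ (one p) (one r) ⟩
    + 2                                               ∎
    where
    open ≡-Reasoning
    one : ∀ p → weight oneHot p ≡ 1ℤ
    one p = begin
      weight oneHot p                  ≡⟨ +-identityʳ _ ⟨
      weight oneHot p + 0ℤ             ≡⟨ ∑-cong-except p (λ a p≢a → cong ⟨_⟩ (dec-false (p Fin.≟ a) p≢a)) ⟩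
      ∑[ a < q ] 0ℤ + ⟨ oneHot p p ⟩   ≡⟨ cong₂ _+_ (sum-replicate-zero q) (cong ⟨_⟩ (dec-true (p Fin.≟ p) refl)) ⟩
      1ℤ                               ∎
    no-common : common oneHot p r ≡ 0ℤ
    no-common = trans (sum-cong-≗ pointwise) (sum-replicate-zero q)
      where
      pointwise : ∀ a → ⟨ oneHot p a ∧ oneHot r a ⟩ ≡ 0ℤ
      pointwise a with p Fin.≟ a | r Fin.≟ a
      ... | yes p≡a | yes r≡a = ⊥-elim (p≢r (trans p≡a (sym r≡a)))
      ... | yes _   | no  _   = refl
      ... | no  _   | _       = refl

  incidence : ∀ {q n m} → (Fin m → Word q n) → Matrix m (n ℕ.* q)
  incidence {q} {n} C x j = oneHot (lookup (C x) (quotient {n} q j)) (remainder {n} q j)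

  incidence-combine : ∀ {q n m} (C : Fin m → Word q n) x i a →
                      incidence C x (combine i a) ≡ oneHot (lookup (C x) i) a
  incidence-combine C x i a =
    cong (λ ia → oneHot (lookup (C x) (proj₁ ia)) (proj₂ ia)) (Fin.remQuot-combine i a)

  incidence-distance : ∀ {q n m} (C : Fin m → Word q n) x y →
                       distance (incidence C) x y ≡ + 2 * + d-H (C x) (C y)
  incidence-distance {q} {n} C x y = begin
    distance (incidence C) x y
      ≡⟨ ∑-combine n (λ j → ⟨ incidence C x j xor incidence C y j ⟩) ⟩
    ∑[ i < n ] ∑[ a < q ] ⟨ incidence C x (combine i a) xor incidence C y (combine i a) ⟩
      ≡⟨ sum-cong-≗ (λ i → trans
           (sum-cong-≗ λ a → cong₂ (λ s t → ⟨ s xor t ⟩) (incidence-combine C x i a) (incidence-combine C y i a))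
           (oneHot-distance (lookup (C x) i) (lookup (C y) i))) ⟩
    ∑[ i < n ] (+ 2 * ⟨ differ (lookup (C x) i) (lookup (C y) i) ⟩)
      ≡⟨ *-distribˡ-sum (+ 2) (λ i → ⟨ differ (lookup (C x) i) (lookup (C y) i) ⟩) ⟨
    + 2 * ∑[ i < n ] ⟨ differ (lookup (C x) i) (lookup (C y) i) ⟩
      ≡⟨ cong (λ s → + 2 * s) (∣tabulate∣≡∑ (λ i → differ (lookup (C x) i) (lookup (C y) i))) ⟨
    + 2 * + d-H (C x) (C y) ∎
    where open ≡-Reasoning

  -- Centres of codes.

  -- A sunflower condition: the sets of coordinates in which the rows leave `c` are pairwise
  -- disjoint.
  IsCentre : ∀ {q n m} → (Fin m → Word q n) → Word q n → Set
  IsCentre C c = ∀ {x y} i → lookup (C x) i ≢ lookup c i → lookup (C y) i ≢ lookup c i → x ≡ y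

  -- A symbol `a` with `b (combine i a)` true can serve as the centre at `i`. If there were none,
  -- every word would be an outlier in the column of its own symbol at `i`; words sharing that
  -- symbol would coincide, giving m ≤ q.
  ∃-centre : ∀ {q n m d} (C : Fin m → Word q n) → (∀ {x y} → x ≢ y → d-H (C x) (C y) ≡ d) →
             d ℕ.^ 2 ℕ.+ d ℕ.+ 2 ℕ.< m → q ℕ.< m → ∃ (IsCentre C)
  ∃-centre {q} {n} {m} {d} C equi large q<m = tabulate c , centred
    where
    f = incidence C
    -- The strict inequality in the hypothesis turns + 2 into the + 3 that `sunflower` asks for.
    large′ : + d * + d + + d + + 3 ≤ + m
    large′ = ≤-trans
      (≤-reflexive (trans (cong (λ s → s + + d + + 3) (sym (pos-* d d))) (cong +_ (reassoc d))))
      (+≤+ large)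
      where
      reassoc : ∀ d → d ℕ.* d ℕ.+ d ℕ.+ 3 ≡ ℕ.suc (d ℕ.^ 2 ℕ.+ d ℕ.+ 2)
      reassoc d = trans (ℕ.+-suc (d ℕ.* d ℕ.+ d) 2)
        (cong (λ s → ℕ.suc (d ℕ.* s ℕ.+ d ℕ.+ 2)) (sym (ℕ.*-identityʳ d)))
    flower = sunflower f (nonneg {d})
      (λ {x} {y} x≢y → trans (incidence-distance C x y) (cong (λ s → + 2 * + s) (equi x≢y))) large′
    b = proj₁ flower
    unique = proj₂ flower

    centre-at : ∀ i → ∃ λ a → b (combine i a) ≡ true
    centre-at i with Fin.any? (λ a → b (combine i a) Bool.≟ true)
    ... | yes found = found
    ... | no  none  = ⊥-elim (ℕ.<⇒≱ q<m (Fin.injective⇒≤ symbol-injective))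
      where
      outlier : ∀ {x a} → lookup (C x) i ≡ a → f x (combine i a) ≢ b (combine i a)
      outlier {x} {a} x≡a f≡b = none (a , (begin
        b (combine i a)             ≡⟨ f≡b ⟨
        f x (combine i a)           ≡⟨ incidence-combine C x i a ⟩
        oneHot (lookup (C x) i) a   ≡⟨ dec-true (lookup (C x) i Fin.≟ a) x≡a ⟩
        true                        ∎))
        where open ≡-Reasoning
      symbol-injective : Injective _≡_ _≡_ (λ x → lookup (C x) i)
      symbol-injective {x} {y} eq = unique (combine i (lookup (C y) i)) (outlier eq) (outlier refl)

    c : Fin n → Fin q
    c = proj₁ ∘ centre-at

    centred : IsCentre C (tabulate c)
    centred {x} {y} i x≢c y≢c = unique (combine i (c i)) (outlier x≢c) (outlier y≢c)
      where
      outlier : ∀ {x} → lookup (C x) i ≢ lookup (tabulate c) i → f x (combine i (c i)) ≢ b (combine i (c i))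
      outlier {x} x≢c f≡b
        with lookup (C x) i Fin.≟ c i
           | trans (sym (incidence-combine C x i (c i))) (trans f≡b (proj₂ (centre-at i)))
      ... | yes x≡c | _ = x≢c (trans x≡c (sym (lookup∘tabulate c i)))
      ... | no  _   | ()

  -- Double counting of the pairs (x , i) where row `x` leaves `c`: each row has `e` of them, each
  -- coordinate at most one.
  total-radius : ∀ {q n m e} (C : Fin m → Word q n) {c} → IsCentre C c →
                 (∀ x → d-H (C x) c ≡ e) → m ℕ.* e ℕ.≤ n
  total-radius {q} {n} {m} {e} C {c} centred radius = drop‿+≤+ (begin
    + (m ℕ.* e)                                            ≡⟨ pos-* m e ⟩
    + m * + e                                              ≡⟨ ∑-const m (+ e) ⟨
    ∑[ x < m ] (+ e)
      ≡⟨ sum-cong-≗ (λ x → trans (sym (∣tabulate∣≡∑ (away x))) (cong +_ (radius x))) ⟨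
    ∑[ x < m ] ∑[ i < n ] ⟨ away x i ⟩                     ≡⟨ ∑-comm (λ x i → ⟨ away x i ⟩) ⟩
    ∑[ i < n ] ∑[ x < m ] ⟨ away x i ⟩
      ≤⟨ ∑-mono (λ i → ∑-⟨⟩≤1 λ hx hy → centred i (differ-true hx) (differ-true hy)) ⟩
    ∑[ i < n ] 1ℤ                                          ≡⟨ trans (∑-const n 1ℤ) (*-identityʳ (+ n)) ⟩
    + n                                                    ∎)
    where
    open ≤-Reasoning
    away : Fin m → Fin n → Bool
    away x i = differ (lookup (C x) i) (lookup c i)

open Counting using (IsCentre; ∃-centre; total-radius)
open import Data.Nat.Base using (ℕ; NonZero; NonTrivial; _+_; _*_; _^_; _/_; _⊔_; _≤_; _>_)
open import Data.Nat.Divisibility using (_∣_)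
open import Data.Integer.Base using (+_)
open import Data.Rational.Base as ℚ using ()
open import Data.List.Base using (List; length)
open import Data.List.Relation.Unary.Unique.Propositional using (Unique)
open import Data.Product.Base using (_×_)
open import Relation.Unary using (_∈_; _∖_; ｛_｝)

import Data.Bool.Properties as Bool
open import Data.Empty using (⊥; ⊥-elim)
open import Data.Fin.Base using (Fin; zero; suc; toℕ)
import Data.Fin.Properties as Fin
open import Data.Fin.Subset as Subset using (Subset; ∣_∣; inside; outside; _─_)
import Data.Fin.Subset.Properties as Subset
import Data.Integer.Base as ℤ
import Data.Integer.Properties as ℤ
open import Data.List.Base as List using ([]; _∷_)
open import Data.List.Membership.Propositional.Properties using (∈-lookup)
open import Data.List.Relation.Unary.All as All using (_∷_)
open import Data.List.Relation.Unary.AllPairs using (_∷_)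
open import Data.List.Relation.Unary.Any as Any using (here; there)
open import Data.List.Relation.Unary.Any.Properties using (lookup-index)
open import Data.Nat.Base using (_<_; suc; s≤s)
open import Data.Nat.Divisibility using (divides-refl)
open import Data.Nat.DivMod using (/-monoˡ-≤; m*n/n≡m)
import Data.Nat.Properties as ℕ
open import Data.Product.Base using (∃; _,_; proj₁; proj₂)
import Data.Rational.Properties as ℚ
import Data.Rational.Unnormalised.Base as ℚᵘ
import Data.Rational.Unnormalised.Properties as ℚᵘ
open import Data.Vec.Base using ([]; _∷_; lookup; there)
open import Data.Vec.Properties
  using ([]=⇒lookup; lookup⇒[]=; lookup∘tabulate; lookup-replicate; tabulate-cong; ≡-dec)
open import Function.Base using (_∘_)
open import Function.Bundles using (mk⇔)
open import Function.Definitions using (Injective)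
open import Level using (0ℓ)
open import Relation.Binary.PropositionalEquality
open import Relation.Nullary using (¬?; yes; no; does)
open import Relation.Nullary.Decidable using (dec-true; dec-false; does-⇔; decidable-stable)
open import Relation.Unary using (Pred; Decidable)

-- Lists, subsets and the zero word.

Unique⇒lookup-injective : ∀ {A : Set} {xs : List A} → Unique xs → Injective _≡_ _≡_ (List.lookup xs)
Unique⇒lookup-injective (_ ∷ _)   {zero}  {zero}  _  = refl
Unique⇒lookup-injective (x∉ ∷ _)  {zero}  {suc j} eq = ⊥-elim (All.lookup x∉ (∈-lookup j) eq)
Unique⇒lookup-injective (x∉ ∷ _)  {suc i} {zero}  eq = ⊥-elim (All.lookup x∉ (∈-lookup i) (sym eq))
Unique⇒lookup-injective (_ ∷ xs!) {suc i} {suc j} eq = cong suc (Unique⇒lookup-injective xs! eq)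

module _ {n} {P : Pred (Fin n) 0ℓ} (P? : Decidable P) where

  ∈⁅⁆ᵈ⁻ : ∀ {i} → i Subset.∈ ⁅ P? ⁆ᵈ → P i
  ∈⁅⁆ᵈ⁻ {i} i∈ = decidable-stable (P? i) λ ¬p → Bool.not-¬ (dec-false (P? i) ¬p)
    (trans (sym (lookup∘tabulate (does ∘ P?) i)) ([]=⇒lookup i∈))

  ∈⁅⁆ᵈ⁺ : ∀ {i} → P i → i Subset.∈ ⁅ P? ⁆ᵈ
  ∈⁅⁆ᵈ⁺ {i} p = lookup⇒[]= i _ (trans (lookup∘tabulate (does ∘ P?) i) (dec-true (P? i) p))

x∈p─q⇒x∉q : ∀ {n} {p q : Subset n} {x} → x Subset.∈ p ─ q → x Subset.∉ q
x∈p─q⇒x∉q {p = _ ∷ _} {outside ∷ q} (there x∈p─q) (there x∈q) = x∈p─q⇒x∉q x∈p─q x∈q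
x∈p─q⇒x∉q {p = _ ∷ _} {inside  ∷ q} (there x∈p─q) (there x∈q) = x∈p─q⇒x∉q x∈p─q x∈q

module _ {q n : ℕ} .{{_ : NonTrivial q}} where

  toℕ≡0⇒≡lookup-0ʷ : ∀ (x : Word q n) i → toℕ (lookup x i) ≡ 0 → lookup x i ≡ lookup 0ʷ i
  toℕ≡0⇒≡lookup-0ʷ x i eq = Fin.toℕ-injective (trans eq
    (sym (trans (cong toℕ (lookup-replicate i _)) (Fin.toℕ-fromℕ< _))))

  toℕ-lookup-0ʷ : ∀ i → toℕ (lookup (0ʷ {q} {n}) i) ≡ 0
  toℕ-lookup-0ʷ i = trans (cong toℕ (lookup-replicate i _)) (Fin.toℕ-fromℕ< _)

  wt≡d-H-0ʷ : ∀ (x : Word q n) → wt x ≡ d-H 0ʷ x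
  wt≡d-H-0ʷ x = cong ∣_∣ (tabulate-cong λ i → does-⇔
    (mk⇔ (λ x≢0 0≡x → x≢0 (trans (cong toℕ (sym 0≡x)) (toℕ-lookup-0ʷ i)))
         (λ 0≢x x≡0 → 0≢x (sym (toℕ≡0⇒≡lookup-0ʷ x i x≡0))))
    (¬? (toℕ (lookup x i) ℕ.≟ 0)) (¬? (lookup 0ʷ i Fin.≟ lookup x i)))

-- Radii around the centre and the Δ-system.

-- A coordinate where x and y differ is one where exactly one of them leaves c.
d-H-via : ∀ {q n} (x y c : Word q n) → (∀ i → lookup x i ≢ lookup c i → lookup y i ≢ lookup c i → ⊥) →
          d-H x y ≡ d-H x c + d-H y c
d-H-via []      []      []      _  = refl
d-H-via (a ∷ x) (b ∷ y) (e ∷ c) ex with a Fin.≟ b | a Fin.≟ e | b Fin.≟ e | d-H-via x y c (ex ∘ suc)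
... | _        | no a≢e   | no b≢e   | _  = ⊥-elim (ex zero a≢e b≢e)
... | yes refl | yes refl | yes _    | eq = eq
... | yes refl | yes refl | no b≢e   | _  = ⊥-elim (b≢e refl)
... | yes refl | no a≢e   | yes refl | _  = ⊥-elim (a≢e refl)
... | no a≢b   | yes refl | yes refl | _  = ⊥-elim (a≢b refl)
... | no _     | yes _    | no _     | eq = trans (cong suc eq) (sym (ℕ.+-suc _ _))
... | no _     | no _     | yes _    | eq = cong suc eq

module Star {q n d} (C : List (Word q n)) (C! : Unique C) (equi : Equidistant ⟦ C ⟧ d)
            (large : d ^ 2 + d + 2 < length C) (q< : q < length C) where

  private
    row : Fin (length C) → Word q n
    row = List.lookup C

    centred-rows : ∃ (IsCentre row)
    centred-rows = ∃-centre row
      (λ {i} {j} i≢j → Equidistant.constant equi (∈-lookup i) (∈-lookup j) (i≢j ∘ Unique⇒lookup-injective C!))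
      large q<

  centre : Word q n
  centre = proj₁ centred-rows

  centred : ∀ {x y i} → x ∈ ⟦ C ⟧ → y ∈ ⟦ C ⟧ →
            lookup x i ≢ lookup centre i → lookup y i ≢ lookup centre i → x ≡ y
  centred {x} {y} {i} x∈ y∈ x≢ y≢ = begin
    x                     ≡⟨ lookup-index x∈ ⟩
    row (Any.index x∈)    ≡⟨ cong row (proj₂ centred-rows i
                               (x≢ ∘ trans (cong (λ w → lookup w i) (lookup-index x∈)))
                               (y≢ ∘ trans (cong (λ w → lookup w i) (lookup-index y∈)))) ⟩
    row (Any.index y∈)    ≡⟨ lookup-index y∈ ⟨
    y                     ∎
    where open ≡-Reasoning

  radii-sum : ∀ {x y} → x ∈ ⟦ C ⟧ → y ∈ ⟦ C ⟧ → x ≢ y → d-H x centre + d-H y centre ≡ d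
  radii-sum {x} {y} x∈ y∈ x≢y = trans
    (sym (d-H-via x y centre λ i p r → x≢y (centred x∈ y∈ p r)))
    (Equidistant.constant equi x∈ y∈ x≢y)

  -- Radii of distinct words add up to `d`. Comparing two words with a third shows that their radii
  -- agree, so three distinct words already force the common value d / 2.
  equal-radii : ∃ λ e → e + e ≡ d × (∀ {x} → x ∈ ⟦ C ⟧ → d-H x centre ≡ e)
  -- Three words exist because d² + d + 2 ≥ 2. The list is generalised to `L` so that it can be
  -- split while membership still refers to `C`.
  equal-radii = go C C! (ℕ.≤-trans (s≤s (ℕ.m≤n+m 2 (d ^ 2 + d))) large) (λ x∈ → x∈)
    where
    go : ∀ L → Unique L → 3 ≤ length L → (∀ {x} → x ∈ ⟦ L ⟧ → x ∈ ⟦ C ⟧) →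
         ∃ λ e → e + e ≡ d × (∀ {x} → x ∈ ⟦ C ⟧ → d-H x centre ≡ e)
    go (_ ∷ [])      _ (s≤s ()) _
    go (_ ∷ _ ∷ [])  _ (s≤s (s≤s ())) _
    go (x ∷ y ∷ z ∷ _) ((x≢y ∷ x≢z ∷ _) ∷ (y≢z ∷ _) ∷ _) _ ⊆C =
      r x , trans (cong (_+_ (r x)) (sym ry≡rx)) x+y , radius
      where
      r = λ w → d-H w centre
      x∈ = ⊆C (here refl)
      y∈ = ⊆C (there (here refl))
      z∈ = ⊆C (there (there (here refl)))
      x+y = radii-sum x∈ y∈ x≢y
      ry≡rx : r y ≡ r x
      ry≡rx = ℕ.+-cancelʳ-≡ (r z) _ _ (trans (radii-sum y∈ z∈ y≢z) (sym (radii-sum x∈ z∈ x≢z)))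
      radius : ∀ {w} → w ∈ ⟦ C ⟧ → r w ≡ r x
      radius {w} w∈ with ≡-dec Fin._≟_ w x
      ... | yes refl = refl
      ... | no  w≢x  = trans (ℕ.+-cancelʳ-≡ (r x) _ _
              (trans (radii-sum w∈ x∈ w≢x) (sym (trans (ℕ.+-comm (r y) (r x)) x+y)))) ry≡rx

  radius : ℕ
  radius = proj₁ equal-radii

  radius*2≡d : radius * 2 ≡ d
  radius*2≡d = trans (ℕ.*-comm radius 2)
    (trans (cong (_+_ radius) (ℕ.+-identityʳ radius)) (proj₁ (proj₂ equal-radii)))

  d-H-centre : ∀ {x} → x ∈ ⟦ C ⟧ → d-H x centre ≡ radius
  d-H-centre = proj₂ (proj₂ equal-radii)

  length*d≤2*n : length C * d ≤ 2 * n
  length*d≤2*n = begin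
    length C * d              ≡⟨ cong (_*_ (length C)) radius*2≡d ⟨
    length C * (radius * 2)   ≡⟨ ℕ.*-assoc (length C) radius 2 ⟨
    length C * radius * 2     ≤⟨ ℕ.*-monoˡ-≤ 2 (total-radius row {centre} (proj₂ centred-rows)
                                                (d-H-centre ∘ ∈-lookup)) ⟩
    n * 2                     ≡⟨ ℕ.*-comm n 2 ⟩
    2 * n                     ∎
    where open ℕ.≤-Reasoning

  module _ .{{_ : NonTrivial q}} (0∈C : 0ʷ ∈ ⟦ C ⟧) where

    private
      in-supp⁻ : ∀ (x : Word q n) {i} → i Subset.∈ supp x → toℕ (lookup x i) ≢ 0
      in-supp⁻ x = ∈⁅⁆ᵈ⁻ (λ i → ¬? (toℕ (lookup x i) ℕ.≟ 0))

      in-supp⁺ : ∀ (x : Word q n) {i} → toℕ (lookup x i) ≢ 0 → i Subset.∈ supp x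
      in-supp⁺ x = ∈⁅⁆ᵈ⁺ (λ i → ¬? (toℕ (lookup x i) ℕ.≟ 0))

    -- On the support of the centre the word 0 is the one that leaves it, so no other word can.
    agrees-on-kernel : ∀ {x i} → x ∈ ⟦ C ⟧ ∖ ｛ 0ʷ ｝ → i Subset.∈ supp centre →
                       lookup x i ≡ lookup centre i
    agrees-on-kernel {x} {i} (x∈ , 0≢x) i∈ = decidable-stable (lookup x i Fin.≟ lookup centre i) λ x≢ →
      0≢x (centred 0∈C x∈ (λ 0≡c → in-supp⁻ centre i∈ (trans (cong toℕ (sym 0≡c)) (toℕ-lookup-0ʷ i))) x≢)

    -- Off its support the centre is 0, while `x` is not.
    leaves-off-kernel : ∀ (x : Word q n) {i} → i Subset.∈ supp x ─ supp centre → lookup x i ≢ lookup centre i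
    leaves-off-kernel x {i} i∈ x≡c = x∈p─q⇒x∉q i∈ (in-supp⁺ centre
      (in-supp⁻ x (Subset.p─q⊆p (supp x) (supp centre) i∈) ∘ trans (cong toℕ x≡c)))

    isΔSystem : IsΔSystem q n d radius (⟦ C ⟧ ∖ ｛ 0ʷ ｝)
    isΔSystem = record
      { ⊆-Johnson = λ {x} (x∈ , 0≢x) → trans (wt≡d-H-0ʷ x) (Equidistant.constant equi 0∈C x∈ 0≢x)
      -- The kernel size is the distance from 0 to the centre, that is, the radius at the codeword
      -- 0.
      ; kernel    = supp centre , trans (wt≡d-H-0ʷ centre) (d-H-centre 0∈C) , record
        { agree    = λ x∈ y∈ _ i∈ →
            let x≡c = agrees-on-kernel x∈ i∈ in
            trans x≡c (sym (agrees-on-kernel y∈ i∈)) , in-supp⁻ centre i∈ ∘ trans (cong toℕ (sym x≡c))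
        ; disjoint = λ {x} {y} (x∈ , _) (y∈ , _) x≢y (i , i∈) →
            let i∈x , i∈y = Subset.x∈p∩q⁻ _ _ i∈ in
            x≢y (centred x∈ y∈ (leaves-off-kernel x i∈x) (leaves-off-kernel y i∈y))
        }
      }

-- Numerical thresholds and the theorem.

-- The fractions in `ℚ` are reduced to lowest terms; in the unnormalised rationals the inequality is
-- plain cross-multiplication.
/2≤/1⇒≤2* : ∀ a n → (+ a) ℚ./ 2 ℚ.≤ (+ n) ℚ./ 1 → a ≤ 2 * n
/2≤/1⇒≤2* a n a/2≤n = begin
  a      ≡⟨ ℕ.*-identityʳ a ⟨
  a * 1  ≤⟨ ℤ.drop‿+≤+ (subst₂ ℤ._≤_
              (sym (ℤ.pos-* a 1)) (sym (ℤ.pos-* n 2)) (ℚᵘ.drop-*≤* unnormalised)) ⟩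
  n * 2  ≡⟨ ℕ.*-comm n 2 ⟩
  2 * n  ∎
  where
  open ℕ.≤-Reasoning
  -- `mkℚᵘ` stores the denominator minus one, so 1 and 0 stand for 2 and 1.
  unnormalised : ℚᵘ.mkℚᵘ (+ a) 1 ℚᵘ.≤ ℚᵘ.mkℚᵘ (+ n) 0
  unnormalised = ℚᵘ.≤-respˡ-≃ (ℚ.toℚᵘ-fromℚᵘ _)
    (ℚᵘ.≤-respʳ-≃ (ℚ.toℚᵘ-fromℚᵘ _) (ℚ.toℚᵘ-mono-≤ a/2≤n))

*≤⇒≤/ : ∀ {m n} d .{{_ : NonZero d}} → m * d ≤ n → m ≤ n / d
*≤⇒≤/ {m} d m*d≤n = ℕ.≤-trans (ℕ.≤-reflexive (sym (m*n/n≡m m d))) (/-monoˡ-≤ d m*d≤n)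

corollary11 : (q n : ℕ) .{{_ : NonTrivial q}} .{{_ : NonZero n}} →
    (C : List (Word q n)) → Unique C →
    (d : ℕ) (equidistant : Equidistant ⟦ C ⟧ d) →
    let instance d≢0 = equidistant⇒nonZero equidistant in
    (0ʷ ∈ ⟦ C ⟧ → length C > (d ^ 2 + d + 2) ⊔ q →
    2 ∣ d × IsΔSystem q n d (d / 2) (⟦ C ⟧ ∖ ｛ 0ʷ ｝))
    × length C ≤ (d ^ 2 + d + 2) ⊔ q ⊔ (2 * n / d)
    × ((+ n) ℚ./ 1 ℚ.≥ ((+ (d * (d ^ 2 + d + 2))) ℚ./ 2) ℚ.⊔ ((+ (d * q)) ℚ./ 2) →
    length C ≤ 2 * n / d)
corollary11 q n C C! d equi = Δ-system , bound , λ n≥ →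
    ℕ.≤-trans bound (ℕ.⊔-lub (ℕ.⊔-lub
      (threshold (d ^ 2 + d + 2) (ℚ.≤-trans (ℚ.p≤p⊔q _ _) n≥))
      (threshold q (ℚ.≤-trans (ℚ.p≤q⊔p ((+ (d * (d ^ 2 + d + 2))) ℚ./ 2) _) n≥))) ℕ.≤-refl)
  where
  instance _ = equidistant⇒nonZero equi

  t = d ^ 2 + d + 2

  Δ-system : 0ʷ ∈ ⟦ C ⟧ → length C > t ⊔ q → 2 ∣ d × IsΔSystem q n d (d / 2) (⟦ C ⟧ ∖ ｛ 0ʷ ｝)
  Δ-system 0∈C large = subst (2 ∣_) radius*2≡d (divides-refl radius)
                     , subst (λ l → IsΔSystem q n d l _) radius≡d/2 (isΔSystem 0∈C)
    where
    open Star C C! equi (ℕ.m⊔n<o⇒m<o t q large) (ℕ.m⊔n<o⇒n<o t q large)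
    radius≡d/2 : radius ≡ d / 2
    radius≡d/2 = trans (sym (m*n/n≡m radius 2)) (cong (_/ 2) radius*2≡d)

  bound : length C ≤ t ⊔ q ⊔ (2 * n / d)
  bound with length C ℕ.≤? t ⊔ q
  ... | yes small = ℕ.≤-trans small (ℕ.m≤m⊔n _ _)
  ... | no  large = ℕ.≤-trans (*≤⇒≤/ d length*d≤2*n) (ℕ.m≤n⊔m (t ⊔ q) _)
    where open Star C C! equi (ℕ.m⊔n<o⇒m<o t q (ℕ.≰⇒> large)) (ℕ.m⊔n<o⇒n<o t q (ℕ.≰⇒> large))

  -- Used at `t` and at `q`: each lower bound on `n` makes the corresponding entry of the maximum at
  -- most the last one.
  threshold : ∀ s → (+ (d * s)) ℚ./ 2 ℚ.≤ (+ n) ℚ./ 1 → s ≤ 2 * n / d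
  threshold s ds/2≤n = *≤⇒≤/ d
    (ℕ.≤-trans (ℕ.≤-reflexive (ℕ.*-comm s d)) (/2≤/1⇒≤2* (d * s) n ds/2≤n))
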